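{- Let $a,c$ be positive integers. Then there exist constants $\kappa>0$ and $N$ (depending only on $a$ and $c$) such that for every $n\ge N$ and every coloring $f:[n]\to\{ -1,1\}$, the number of triples $(x,y,z)\in[n]^3$ with $ax+ay-cz=0$ and $f(x)=f(y)=f(z)$ is at least $\kappa n^2$.
   Context: $[n]=\{1,2,\dots,n\}$; a coloring is any function $f:[n]\to\{ -1,1\}$, and a solution is monochromatic if all three of its entries receive the same color. -}

module Defs where

open import Data.Nat using (ℕ; suc; _+_; _*_)
open import Data.Nat.Properties using (_≟_)
open import Data.Fin using (Fin; toℕ)
open import Data.Sign using (Sign) renaming (_≟_ to _≟ˢ_)
open import Data.List using (List; length; filter; allFin; cartesianProduct)
open import Data.Product using (_×_; _,_)
open import Relation.Nullary using (Dec; _×-dec_)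

-- [n] = {1,…,n} is represented by Fin n, where i : Fin n stands for the integer toℕ i + 1.
elt : {n : ℕ} → Fin n → ℕ
elt i = suc (toℕ i)

Coloring : ℕ → Set
Coloring n = Fin n → Sign

triples : (n : ℕ) → List (Fin n × Fin n × Fin n)
triples n = cartesianProduct (allFin n) (cartesianProduct (allFin n) (allFin n))

-- (x,y,z) is a monochromatic solution of a x + a y - c z = 0,
-- written over ℕ as a x + a y = c z.
MonoSol : (a c : ℕ) {n : ℕ} → Coloring n → Fin n × Fin n × Fin n → Set
MonoSol a c f (x , y , z) =
  (a * elt x + a * elt y ≡ c * elt z) × (f x ≡ f z) × (f y ≡ f z)
  where open import Relation.Binary.PropositionalEquality using (_≡_)

monoSol? : (a c : ℕ) {n : ℕ} (f : Coloring n) → (t : Fin n × Fin n × Fin n) → Dec (MonoSol a c f t)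
monoSol? a c f (x , y , z) =
  (a * elt x + a * elt y ≟ c * elt z) ×-dec ((f x ≟ˢ f z) ×-dec (f y ≟ˢ f z))

monoCount : (a c : ℕ) {n : ℕ} → Coloring n → ℕ
monoCount a c {n} f = length (filter (monoSol? a c f) (triples n))

{-# OPTIONS --safe #-}

-- Put μ = 2a/c, so that a monochromatic solution is a monochromatic triple x, y, μ(x + y)/2.
-- Fix u, v and suppose that no solution built from a certain finite set of integer combinations
-- of u and v is monochromatic. Then two pairs of terms of the progression u + iv with equal sums
-- cannot be monochromatic in different colours, and this forces a long monochromatic run. Since
-- μ times the midpoint of two points of equal colour has the opposite colour, multiplying the
-- run by 1, μ, μ², μ³ gives runs of alternating colours. If μ = 1 this is absurd. Otherwise let
-- ρ > 1 be μ or 1/μ. For x, y, z on the run, the progression x, ρy, 2ρy − x, … has a constant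
-- colour from ρy on, and ρy, ρ²z, 2ρ²z − ρy, … has a constant, opposite colour from ρ²z on; for
-- suitable x, y, z the two progressions meet, a contradiction.
-- So every pair (u, v) with u, v ≤ n/D yields a monochromatic solution, and as x and y are
-- independent combinations of u and v, a solution arises from boundedly many pairs.
module Submission where

open import Defs
open import Data.Nat using (ℕ; zero; suc; _+_; _*_; _≤_; _<_; _≥_; _^_; z≤n; s≤s; >-nonZero)
open import Data.Nat.Properties
open import Data.Nat.DivMod using (_/_; m≡m%n+[m/n]*n; m%n<n; m/n*n≤m; m≥n⇒m/n>0)
open import Data.Nat.Tactic.RingSolver using (solve-∀)
open import Data.Fin using (Fin; zero; suc; toℕ; fromℕ<; combine; remQuot)
open import Data.Fin.Properties using (any?; toℕ-fromℕ<; toℕ<n; toℕ-injective; combine-injective; combine-remQuot; injective⇒≤)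
open import Data.Sign using (Sign; opposite) renaming (_≟_ to _≟ˢ_; + to plus; - to minus)
open import Data.Sign.Properties using () renaming (opposite-involutive to opposite²)
open import Data.Product using (Σ; ∃; _×_; _,_; uncurry)
open import Data.Empty using (⊥)
open import Data.List using (List; []; _∷_; _++_; map; upTo; length; lookup; filter)
open import Data.List.Membership.Propositional using (_∈_)
open import Data.List.Membership.Propositional.Properties using (∈-map⁺; ∈-++⁺ˡ; ∈-++⁺ʳ; ∈-upTo⁺; ∈-filter⁺; ∈-cartesianProduct⁺; ∈-allFin; ∈-lookup)
open import Data.List.Relation.Unary.All as All using (All; []; _∷_; universal)
open import Data.List.Relation.Unary.All.Properties using (map⁺; ++⁺)
open import Data.List.Relation.Unary.Any using (here; there; index)
open import Data.List.Relation.Unary.Any.Properties using (lookup-index)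
open import Function using (Injective; case_of_)
open import Relation.Binary.Definitions using (tri<; tri≈; tri>)
open import Relation.Binary.PropositionalEquality using (_≡_; _≢_; refl; sym; trans; cong; cong₂; subst; subst₂; module ≡-Reasoning)
open import Relation.Nullary using (¬_; ¬?; Dec; yes; no; contradiction; _×-dec_)
open import Relation.Nullary.Decidable using (decidable-stable)

-- Two-coloured sequences and long monochromatic runs.

≢⇒≡opposite : ∀ {x y : Sign} → x ≢ y → x ≡ opposite y
≢⇒≡opposite {plus}  {plus}  x≢y = contradiction refl x≢y
≢⇒≡opposite {plus}  {minus} _   = refl
≢⇒≡opposite {minus} {plus}  _   = refl
≢⇒≡opposite {minus} {minus} x≢y = contradiction refl x≢y

≡⇒≢opposite : ∀ {x y : Sign} → x ≡ y → x ≢ opposite y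
≡⇒≢opposite {plus}  refl ()
≡⇒≢opposite {minus} refl ()

≢-≢⇒≡ : ∀ {x y z : Sign} → x ≢ z → y ≢ z → x ≡ y
≢-≢⇒≡ x≢z y≢z = trans (≢⇒≡opposite x≢z) (sym (≢⇒≡opposite y≢z))

Convex : (ℕ → Sign) → ℕ → Set
Convex g N = ∀ {i j k l} → i < j → k < l → j ≤ N → l ≤ N → i + j ≡ k + l →
             g i ≡ g j → g k ≡ g l → g i ≡ g k

locally-constant⇒constant : ∀ (g : ℕ → Sign) L → (∀ {t} → t < L → g t ≡ g (suc t)) →
                            ∀ t → t ≤ L → g t ≡ g 0
locally-constant⇒constant g L eq zero    _   = refl
locally-constant⇒constant g L eq (suc t) t<L =
  trans (sym (eq t<L)) (locally-constant⇒constant g L eq t (<⇒≤ t<L))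

-- After a colour change at i, the colour of 1 + i is permanent from its second occurrence on.
permanent : ∀ {g N} → Convex g N → ∀ {i k} → g i ≢ g (suc i) → suc i < k → g k ≡ g (suc i) →
            ∀ s → k + s ≤ N → g (k + s) ≡ g (suc i)
permanent {g} conv {i} {k} change i<k gk zero _ = trans (cong g (+-identityʳ k)) gk
permanent {g} {N} conv {i} {k} change i<k gk (suc s) le with g (k + suc s) ≟ˢ g (suc i)
... | yes eq = eq
-- The pairs `(i, k + suc s)` and `(suc i, k + s)` have equal sums. With only two colours the first
-- is monochromatic in the colour of `i`, the second in that of `suc i`.
... | no neq = contradiction
  (conv (m<n⇒m<1+n (<-trans (n<1+n i) i<k+s)) i<k+s (subst (_≤ N) (+-suc k s) le) (<⇒≤ le′)
        (+-suc i (k + s))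
        (trans (≢-≢⇒≡ change neq) (cong g (+-suc k s)))
        (sym (permanent conv change i<k gk s (<⇒≤ le′))))
  change
  where
  i<k+s : suc i < k + s
  i<k+s = ≤-trans i<k (m≤m+n k s)
  le′ : k + s < N
  le′ = subst (_≤ N) (+-suc k s) le

-- Three cases: no change among the first `L` steps; a change at `i` whose new colour is absent from
-- the `L` positions after `suc i`, which then all carry the old colour; or a recurrence of the new
-- colour, which `permanent` prolongs. Each run ends by `3L + 2`.
long-run : ∀ g L → Convex g (L + L + L + 2) →
           Σ ℕ λ st → Σ Sign λ C → (st + L ≤ L + L + L + 2) × (∀ t → t < L → g (st + t) ≡ C)
long-run g L conv with anyUpTo? (λ t → ¬? (g t ≟ˢ g (suc t))) L
... | no ¬change = 0 , g 0 , le , λ t t<L → locally-constant⇒constant g L same t (<⇒≤ t<L)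
  where
  le : L ≤ L + L + L + 2
  le = ≤-trans (m≤m+n L (L + L + 2)) (≤-reflexive (rearrange L))
    where
    rearrange : ∀ L → L + (L + L + 2) ≡ L + L + L + 2
    rearrange = solve-∀
  same : ∀ {t} → t < L → g t ≡ g (suc t)
  same {t} t<L with g t ≟ˢ g (suc t)
  ... | yes eq = eq
  ... | no neq = contradiction (t , t<L , neq) ¬change
... | yes (i , i<L , change) with anyUpTo? (λ t → g (2 + i + t) ≟ˢ g (suc i)) L
...   | no ¬again = 2 + i , g i , le , λ t t<L → ≢-≢⇒≡ (λ eq → ¬again (t , t<L , eq)) change
  where
  le : 2 + i + L ≤ L + L + L + 2
  le = ≤-trans (+-monoˡ-≤ L (s≤s i<L)) (≤-trans (m≤m+n _ (suc L)) (≤-reflexive (rearrange L)))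
    where
    rearrange : ∀ L → suc L + L + suc L ≡ L + L + L + 2
    rearrange = solve-∀
...   | yes (k , k<L , again) =
        2 + i + k , g (suc i) , le ,
        λ t t<L → permanent conv change (m≤m+n (2 + i) k) again t
                    (≤-trans (+-monoʳ-≤ (2 + i + k) (<⇒≤ t<L)) le)
  where
  le : 2 + i + k + L ≤ L + L + L + 2
  le = ≤-trans (+-monoˡ-≤ L (+-mono-≤ (s≤s i<L) (<⇒≤ k<L)))
         (≤-trans (n≤1+n _) (≤-reflexive (rearrange L)))
    where
    rearrange : ∀ L → suc (suc L + L + L) ≡ L + L + L + 2
    rearrange = solve-∀

-- Solution-free progressions and their coefficients.

-- Only two entries lie on the progression; `z` is whatever the equation dictates. The strict
-- `i < j` later lets these two entries determine `b` and `d`.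
NoMono : (a c : ℕ) → (ℕ → Sign) → (M b d : ℕ) → Set
NoMono a c f M b d = ∀ {i j z} → i < j → j ≤ M →
  a * (b + i * d) + a * (b + j * d) ≡ c * z →
  f (b + i * d) ≡ f (b + j * d) → f z ≢ f (b + i * d)

record Progression : Set where
  constructor prog
  field
    α β γ δ : ℕ

  base step : ℕ → ℕ → ℕ
  base u v = α * u + β * v
  step u v = γ * u + δ * v

  -- Positivity of the determinant of the forms `base` and `step`, stated without subtraction.
  Independent : Set
  Independent = γ * β < α * δ

open Progression

level : ℕ → Progression
level ℓ = prog ℓ 0 0 ℓ

-- With w j = u + j v, Q = P + h and ρ = Q / P, these start at m P² w i and m P Q w (i + Q) and
-- have second terms m P Q w (i + Q) and m Q² w (i + Q + P), i.e. up to the scale m P² they are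
-- x, ρy, … and ρy, ρ²z, … for x = w i, y = w (i + Q), z = w (i + Q + P). These x, y, z satisfy
-- ρ(z − y) = y − x, which makes term 1 + Q of the first equal to term P of the second.
lower upper : (m P Q h i : ℕ) → Progression
lower m P Q h i = prog (m * P * P) (m * P * P * i) (m * P * h) (m * P * (h * i + Q * Q))
upper m P Q h i =
  prog (m * P * Q) (m * P * Q * (i + Q)) (m * Q * h) (m * Q * (h * (i + Q) + Q * P))

infixl 7 _*⁺_
_*⁺_ : ∀ {m n} → 1 ≤ m → 1 ≤ n → 1 ≤ m * n
_*⁺_ = *-mono-≤

level-independent : ∀ {ℓ} → 1 ≤ ℓ → Independent (level ℓ)
level-independent pos = pos *⁺ pos

lower-independent : ∀ {m P} h {Q} → 1 ≤ m → 1 ≤ P → 1 ≤ Q → ∀ i → Independent (lower m P Q h i)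
lower-independent {m} {P} h {Q} m⁺ P⁺ Q⁺ i = subst (m * P * h * (m * P * P * i) <_) (expand m P Q h i)
  (m<m+n _ (m⁺ *⁺ P⁺ *⁺ P⁺ *⁺ (m⁺ *⁺ P⁺ *⁺ (Q⁺ *⁺ Q⁺))))
  where
  expand : ∀ m P Q h i → m * P * h * (m * P * P * i) + m * P * P * (m * P * (Q * Q)) ≡
                         m * P * P * (m * P * (h * i + Q * Q))
  expand = solve-∀

upper-independent : ∀ {m P} h {Q} → 1 ≤ m → 1 ≤ P → 1 ≤ Q → ∀ i → Independent (upper m P Q h i)
upper-independent {m} {P} h {Q} m⁺ P⁺ Q⁺ i =
  subst (m * Q * h * (m * P * Q * (i + Q)) <_) (expand m P Q h i)
  (m<m+n _ (m⁺ *⁺ P⁺ *⁺ Q⁺ *⁺ (m⁺ *⁺ Q⁺ *⁺ (Q⁺ *⁺ P⁺))))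
  where
  expand : ∀ m P Q h i →
    m * Q * h * (m * P * Q * (i + Q)) + m * P * Q * (m * Q * (Q * P)) ≡
    m * P * Q * (m * Q * (h * (i + Q) + Q * P))
  expand = solve-∀

-- Propagation of colours along progressions and between levels.

module _ (a c : ℕ) (f : ℕ → Sign) where

  -- Terms 0 and `3 + k` have the same sum as terms 1 and `2 + k`, hence the same third entry `w`.
  -- The inner pair has colour `opposite C` and forces `w` to be `C`, so term `3 + k` cannot be `C`.
  -- Divisibility of `b` and `d` by `c` makes `w` an integer.
  chain : ∀ {M b d} b′ d′ {z C} → NoMono a c f M b d → b ≡ c * b′ → d ≡ c * d′ →
          f b ≡ C → f (b + 1 * d) ≡ opposite C → f z ≡ C → (a + a) * (b + 1 * d) ≡ c * z →
          ∀ k → k < M → f (b + suc k * d) ≡ opposite C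
  chain {M} {b} {d} b′ d′ {z} {C} nm refl refl fb fd fz eqz = go
    where
    f0 : f (b + 0 * d) ≡ C
    f0 = trans (cong f (+-identityʳ b)) fb

    eq₂ : ∀ a b d → a * (b + 0 * d) + a * (b + 2 * d) ≡ (a + a) * (b + 1 * d)
    eq₂ = solve-∀

    eqᵒ : ∀ a c b d k → a * (c * b + 0 * (c * d)) + a * (c * b + k * (c * d)) ≡
                        c * (a * (b + b + k * d))
    eqᵒ = solve-∀

    eqⁱ : ∀ a c b d k → a * (c * b + 1 * (c * d)) + a * (c * b + k * (c * d)) ≡
                        c * (a * (b + b + suc k * d))
    eqⁱ = solve-∀

    go : ∀ k → k < M → f (b + suc k * d) ≡ opposite C
    go zero _ = fd
    -- Here the inner pair would be term 1 taken twice, which `NoMono` excludes; the hypothesis on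
    -- `z`, which is μ times term 1, replaces it.
    go (suc zero) k<M = ≢⇒≡opposite λ f2 →
      nm (s≤s z≤n) k<M (trans (eq₂ a b d) eqz) (trans f0 (sym f2)) (trans fz (sym f0))
    go (suc (suc k)) k<M with go (suc k) (<⇒≤ k<M)
    ... | ih = ≢⇒≡opposite λ f3 →
      nm {z = w} (s≤s z≤n) k<M (eqᵒ a c b′ d′ (3 + k)) (trans f0 (sym f3))
        (trans (≢-≢⇒≡ {z = opposite C} w≢ (λ eq → ≡⇒≢opposite refl eq)) (sym f0))
      where
      w : ℕ
      w = a * (b′ + b′ + (3 + k) * d′)
      w≢ : f w ≢ opposite C
      w≢ fw = nm {z = w} (s≤s (s≤s z≤n)) (<⇒≤ k<M) (eqⁱ a c b′ d′ (2 + k))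
                (trans fd (sym ih)) (trans fw (sym fd))

  module _ (u v : ℕ) where

    pt : (ℓ i : ℕ) → ℕ
    pt ℓ i = ℓ * u + i * (ℓ * v)

    pt-scale : ∀ ℓ ℓ′ i → (a + a) * ℓ ≡ c * ℓ′ → (a + a) * pt ℓ i ≡ c * pt ℓ′ i
    pt-scale ℓ ℓ′ i eq = begin
      (a + a) * pt ℓ i                              ≡⟨ distrib (a + a) ℓ i u v ⟩
      (a + a) * ℓ * u + i * ((a + a) * ℓ * v)       ≡⟨ cong (λ x → x * u + i * (x * v)) eq ⟩
      c * ℓ′ * u + i * (c * ℓ′ * v)                 ≡⟨ distrib c ℓ′ i u v ⟨
      c * pt ℓ′ i                                   ∎
      where
      open ≡-Reasoning
      distrib : ∀ r ℓ i u v → r * (ℓ * u + i * (ℓ * v)) ≡ r * ℓ * u + i * (r * ℓ * v)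
      distrib = solve-∀

    NoMonoOn : ℕ → Progression → Set
    NoMonoOn M p = NoMono a c f M (base p u v) (step p u v)

    level-nomono : ∀ {M} ℓ → NoMonoOn M (level ℓ) → NoMono a c f M (ℓ * u) (ℓ * v)
    level-nomono {M} ℓ = subst (λ b → NoMono a c f M b (ℓ * v)) (+-identityʳ (ℓ * u))

    -- Pairs with equal sums share the third entry `w (i + j)`, integral thanks to the factor `c`.
    -- Its colour differs from that of both pairs, so the pairs agree.
    level-convex : ∀ {M} q → NoMonoOn M (level (c * q)) → Convex (λ i → f (pt (c * q) i)) M
    level-convex q nm {i} {j} {k} {l} i<j k<l j≤M l≤M sum fij fkl =
      ≢-≢⇒≡ (λ eq → level-nomono (c * q) nm {z = w (i + j)} i<j j≤M (mid a c q u v i j) fij (sym eq))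
            (λ eq → level-nomono (c * q) nm {z = w (i + j)} k<l l≤M
                      (trans (mid a c q u v k l) (cong (λ s → c * w s) (sym sum))) fkl (sym eq))
      where
      w : ℕ → ℕ
      w s = a * q * (u + u + s * v)
      mid : ∀ a c q u v i j →
            a * (c * q * u + i * (c * q * v)) + a * (c * q * u + j * (c * q * v)) ≡
            c * (a * q * (u + u + (i + j) * v))
      mid = solve-∀

    -- Terms `i` and `2 + i` have midpoint `pt ℓ (suc i)`, which μ carries to the same position on
    -- level `ℓ′`.
    level-flip : ∀ {M ℓ ℓ′ i C} → NoMonoOn M (level ℓ) → (a + a) * ℓ ≡ c * ℓ′ → 2 + i ≤ M →
                 f (pt ℓ i) ≡ C → f (pt ℓ (2 + i)) ≡ C → f (pt ℓ′ (suc i)) ≡ opposite C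
    level-flip {M} {ℓ} {ℓ′} {i} {C} nm eq le f₀ f₂ = ≢⇒≡opposite λ fz →
      level-nomono ℓ nm {i} {2 + i} {pt ℓ′ (suc i)} (s≤s (n≤1+n i)) le
        (trans (mid a ℓ u v i) (pt-scale ℓ ℓ′ (suc i) eq))
        (trans f₀ (sym f₂)) (trans fz (sym f₀))
      where
      mid : ∀ a ℓ u v i → a * (ℓ * u + i * (ℓ * v)) + a * (ℓ * u + (2 + i) * (ℓ * v)) ≡
                          (a + a) * (ℓ * u + suc i * (ℓ * v))
      mid = solve-∀

    -- `chain` makes the lower progression `opposite C` from its second term on, and the upper one
    -- `C` from its second term on. The levels `ℓ` and `ℓ′` hold the μ-images of these second terms,
    -- as `chain` demands. Term `suc Q` of the lower is term `P` of the upper.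
    chains-meet : ∀ {M} m P h i {ℓ ℓ′} C → let Q = P + h in
      NoMonoOn M (lower (c * m) P Q h i) → NoMonoOn M (upper (c * m) P Q h i) →
      Q < M → 1 ≤ P →
      f (pt (c * m * P * P) i) ≡ C →
      f (pt (c * m * P * Q) (i + Q)) ≡ opposite C →
      f (pt (c * m * Q * Q) (i + (Q + P))) ≡ C →
      (a + a) * (c * m * P * Q) ≡ c * ℓ → f (pt ℓ (i + Q)) ≡ C →
      (a + a) * (c * m * Q * Q) ≡ c * ℓ′ → f (pt ℓ′ (i + (Q + P))) ≡ opposite C →
      ⊥
    chains-meet {M} m P@(suc P-1) h i {ℓ} {ℓ′} C nmˡ nmᵘ Q<M _ fx fy fz eqℓ fℓ eqℓ′ fℓ′ =
      ≡⇒≢opposite on-upper on-lower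
      where
      Q b₁ d₁ b₂ d₂ : ℕ
      Q = P + h
      b₁ = base (lower (c * m) P Q h i) u v
      d₁ = step (lower (c * m) P Q h i) u v
      b₂ = base (upper (c * m) P Q h i) u v
      d₂ = step (upper (c * m) P Q h i) u v

      b₁-pt : ∀ m P i u v → m * P * P * u + m * P * P * i * v ≡ m * P * P * u + i * (m * P * P * v)
      b₁-pt = solve-∀

      b₂-pt : ∀ m P Q i u v → m * P * Q * u + m * P * Q * (i + Q) * v ≡
                              m * P * Q * u + (i + Q) * (m * P * Q * v)
      b₂-pt = solve-∀

      b₁+d₁ : ∀ m P h i u v →
        m * P * P * u + m * P * P * i * v
          + 1 * (m * P * h * u + m * P * (h * i + (P + h) * (P + h)) * v) ≡
        m * P * (P + h) * u + (i + (P + h)) * (m * P * (P + h) * v)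
      b₁+d₁ = solve-∀

      b₂+d₂ : ∀ m P h i u v →
        m * P * (P + h) * u + m * P * (P + h) * (i + (P + h)) * v
          + 1 * (m * (P + h) * h * u + m * (P + h) * (h * (i + (P + h)) + (P + h) * P) * v) ≡
        m * (P + h) * (P + h) * u + (i + (P + h + P)) * (m * (P + h) * (P + h) * v)
      b₂+d₂ = solve-∀

      meet : ∀ m P h i u v →
        m * P * P * u + m * P * P * i * v
          + suc (P + h) * (m * P * h * u + m * P * (h * i + (P + h) * (P + h)) * v) ≡
        m * P * (P + h) * u + m * P * (P + h) * (i + (P + h)) * v
          + P * (m * (P + h) * h * u + m * (P + h) * (h * (i + (P + h)) + (P + h) * P) * v)
      meet = solve-∀

      factorᵇ : ∀ c m P Q w u v → c * m * P * Q * u + c * m * P * Q * w * v ≡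
                                 c * (m * P * Q * u + m * P * Q * w * v)
      factorᵇ = solve-∀

      factorˢ : ∀ c m P α β u v → c * m * P * α * u + c * m * P * β * v ≡
                                 c * (m * P * α * u + m * P * β * v)
      factorˢ = solve-∀

      y-pt : b₁ + 1 * d₁ ≡ pt (c * m * P * Q) (i + Q)
      y-pt = b₁+d₁ (c * m) P h i u v

      z-pt : b₂ + 1 * d₂ ≡ pt (c * m * Q * Q) (i + (Q + P))
      z-pt = b₂+d₂ (c * m) P h i u v

      on-lower : f (b₁ + suc Q * d₁) ≡ opposite C
      on-lower = chain _ _ nmˡ
        (factorᵇ c m P P i u v) (factorˢ c m P h (h * i + Q * Q) u v)
        (trans (cong f (b₁-pt (c * m) P i u v)) fx)
        (trans (cong f y-pt) fy) fℓ
        (trans (cong ((a + a) *_) y-pt) (pt-scale _ ℓ (i + Q) eqℓ)) Q Q<M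

      on-upper : f (b₁ + suc Q * d₁) ≡ C
      on-upper = trans (cong f (meet (c * m) P h i u v)) (trans
        (chain _ _ nmᵘ
          (factorᵇ c m P Q (i + Q) u v) (factorˢ c m Q h (h * (i + Q) + Q * P) u v)
          (trans (cong f (b₂-pt (c * m) P Q i u v)) fy)
          (trans (cong f z-pt) (trans fz (sym (opposite² C)))) fℓ′
          -- `chain` counts from the second term, so term `P` has index `P-1`.
          (trans (cong ((a + a) *_) z-pt) (pt-scale _ ℓ′ (i + (Q + P)) eqℓ′)) P-1
          (≤-trans (m≤m+n P h) (<⇒≤ Q<M)))
        (opposite² C))

    record Run (ℓ st L : ℕ) (C : Sign) : Set where
      constructor mkRun
      field at : ∀ t → t < L → f (pt ℓ (st + t)) ≡ C

    open Run public

    run-shift : ∀ {ℓ st L C} → Run ℓ st (suc L) C → Run ℓ (suc st) L C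
    run-shift {ℓ} {st} run = mkRun λ t t<L →
      trans (cong (λ p → f (pt ℓ p)) (sym (+-suc st t))) (run .at (suc t) (s≤s t<L))

    -- A flip at a position needs both neighbours, so the run loses one position at each end.
    run-flip : ∀ {M ℓ ℓ′ st L C} → NoMonoOn M (level ℓ) → (a + a) * ℓ ≡ c * ℓ′ →
               st + (2 + L) ≤ M → Run ℓ st (2 + L) C → Run ℓ′ (suc st) L (opposite C)
    run-flip {M} {ℓ} {st = st} {L} nm eq le run = mkRun λ t t<L →
      level-flip nm eq
        (≤-trans (≤-reflexive (sym (reassoc st t)))
                 (≤-trans (+-monoʳ-≤ st (s≤s (s≤s (<⇒≤ t<L)))) le))
        (run .at t (≤-trans t<L (m≤n+m L 2)))
        (trans (cong (λ p → f (pt ℓ p)) (sym (reassoc st t))) (run .at (2 + t) (s≤s (s≤s t<L))))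
      where
      reassoc : ∀ st t → st + (2 + t) ≡ 2 + (st + t)
      reassoc = solve-∀

    -- Three flips cut a run of length `7 + R` down to `1 + R`; the earlier runs are trimmed to the
    -- same window. The bound `i ≤ M` keeps the possible starts finite in number.
    alternating-levels : ∀ R {q₀ ℓ₁ ℓ₂ ℓ₃} → let L = 7 + R; M = L + L + L + 2 in
      NoMonoOn M (level (c * q₀)) → NoMonoOn M (level ℓ₁) → NoMonoOn M (level ℓ₂) →
      (a + a) * (c * q₀) ≡ c * ℓ₁ → (a + a) * ℓ₁ ≡ c * ℓ₂ → (a + a) * ℓ₂ ≡ c * ℓ₃ →
      Σ ℕ λ i → Σ Sign λ C → (i ≤ M) ×
        Run (c * q₀) i (suc R) C × Run ℓ₁ i (suc R) (opposite C) ×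
        Run ℓ₂ i (suc R) C × Run ℓ₃ i (suc R) (opposite C)
    alternating-levels R {q₀} {ℓ₁} {ℓ₂} {ℓ₃} nm₀ nm₁ nm₂ eq₀ eq₁ eq₂
      with long-run _ (7 + R) (level-convex q₀ nm₀)
    ... | st , C , le , run₀ =
      3 + st , C , ≤-trans (m≤m+n (3 + st) (4 + R)) (subst (_≤ M) (reassoc₃ st R) le) ,
      truncate 3 (run-shift (run-shift (run-shift (mkRun run₀)))) ,
      truncate 2 (run-shift (run-shift run₁)) , truncate 1 (run-shift run₂) , run₃
      where
      M : ℕ
      M = (7 + R) + (7 + R) + (7 + R) + 2

      reassoc₃ : ∀ st R → st + (7 + R) ≡ 3 + st + (4 + R)
      reassoc₃ = solve-∀

      reassoc₁ : ∀ st R → st + (7 + R) ≡ suc (1 + st + (2 + (3 + R)))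
      reassoc₁ = solve-∀

      reassoc₂ : ∀ st R → st + (7 + R) ≡ suc (suc (2 + st + (2 + (1 + R))))
      reassoc₂ = solve-∀

      truncate : ∀ k {ℓ st C} → Run ℓ st (k + suc R) C → Run ℓ st (suc R) C
      truncate k run = mkRun λ t t<R → run .at t (≤-trans t<R (m≤n+m (suc R) k))

      run₁ : Run ℓ₁ (1 + st) (5 + R) (opposite C)
      run₁ = run-flip nm₀ eq₀ le (mkRun run₀)

      run₂ : Run ℓ₂ (2 + st) (3 + R) C
      run₂ = subst (Run ℓ₂ (2 + st) (3 + R)) (opposite² C)
        (run-flip nm₁ eq₁ (<⇒≤ (subst (_≤ M) (reassoc₁ st R) le)) run₁)

      run₃ : Run ℓ₃ (3 + st) (1 + R) (opposite C)
      run₃ = run-flip nm₂ eq₂ (<⇒≤ (<⇒≤ (subst (_≤ M) (reassoc₂ st R) le))) run₂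

-- Finite unavoidable families of progressions.

-- The family is chosen before `f`, `u` and `v`, which makes the final constants uniform.
Obstruction : ℕ → ℕ → Set
Obstruction a c = Σ ℕ λ M → Σ (List Progression) λ ps → All Independent ps ×
  (∀ f u v → ¬ (∀ {p} → p ∈ ps → NoMonoOn a c f u v M p))

module _ (a c : ℕ) (a⁺ : 1 ≤ a) (c⁺ : 1 ≤ c) where

  private
    r ℓ₀ ℓ₁ ℓ₂ ℓ₃ R M : ℕ
    r = a + a
    -- μᵏ for k = 0, …, 3, with denominators cleared and a spare factor c that makes all the
    -- midpoints below divisible by c.
    ℓ₀ = c * (c * c * c)
    ℓ₁ = c * (c * c * r)
    ℓ₂ = c * (c * r * r)
    ℓ₃ = c * (r * r * r)
    -- `P` and `Q` will be `c` and `r` in some order, so `i`, `i + Q` and `i + Q + P` all lie on a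
    -- run of length `suc R`.
    R = r + c
    M = (7 + R) + (7 + R) + (7 + R) + 2

    r⁺ : 1 ≤ r
    r⁺ = ≤-trans a⁺ (m≤m+n a a)

    up₀ : ∀ c r → r * (c * (c * c * c)) ≡ c * (c * (c * c * r))
    up₀ = solve-∀
    up₁ : ∀ c r → r * (c * (c * c * r)) ≡ c * (c * (c * r * r))
    up₁ = solve-∀
    up₂ : ∀ c r → r * (c * (c * r * r)) ≡ c * (c * (r * r * r))
    up₂ = solve-∀

    levels : List Progression
    levels = level ℓ₀ ∷ level ℓ₁ ∷ level ℓ₂ ∷ []

    levels-independent : All Independent levels
    levels-independent =
      level-independent (c⁺ *⁺ (c⁺ *⁺ c⁺ *⁺ c⁺)) ∷ level-independent (c⁺ *⁺ (c⁺ *⁺ c⁺ *⁺ r⁺)) ∷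
      level-independent (c⁺ *⁺ (c⁺ *⁺ r⁺ *⁺ r⁺)) ∷ []

    ladder : ∀ f u v → (∀ {p} → p ∈ levels → NoMonoOn a c f u v M p) →
      Σ ℕ λ i → Σ Sign λ C → (i ≤ M) ×
        Run a c f u v ℓ₀ i (suc R) C × Run a c f u v ℓ₁ i (suc R) (opposite C) ×
        Run a c f u v ℓ₂ i (suc R) C × Run a c f u v ℓ₃ i (suc R) (opposite C)
    ladder f u v nm = alternating-levels a c f u v R
      (nm (here refl)) (nm (there (here refl))) (nm (there (there (here refl))))
      (up₀ c r) (up₁ c r) (up₂ c r)

    R<M : R < M
    R<M = s≤s (≤-trans (m≤m+n R (6 + 6 + 6 + R + R + 4)) (≤-reflexive (rearrange R)))
      where
      rearrange : ∀ R → R + (6 + 6 + 6 + R + R + 4) ≡ 6 + R + (7 + R) + (7 + R) + 2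
      rearrange = solve-∀

    -- The start `i` of the run depends on the colouring, so the chains for every `i ≤ M` are
    -- included.
    with-chains : (m P Q h : ℕ) → List Progression
    with-chains m P Q h = levels ++ map (lower (c * m) P Q h) (upTo (suc M)) ++
                                    map (upper (c * m) P Q h) (upTo (suc M))

    with-chains-independent : ∀ {m P Q} h → 1 ≤ m → 1 ≤ P → 1 ≤ Q →
                              All Independent (with-chains m P Q h)
    with-chains-independent h m⁺ P⁺ Q⁺ = ++⁺ levels-independent
      (++⁺ (map⁺ (universal (lower-independent h (c⁺ *⁺ m⁺) P⁺ Q⁺) (upTo (suc M))))
           (map⁺ (universal (upper-independent h (c⁺ *⁺ m⁺) P⁺ Q⁺) (upTo (suc M)))))

    lower∈ : ∀ m P Q h {i} → i ≤ M → lower (c * m) P Q h i ∈ with-chains m P Q h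
    lower∈ m P Q h i≤M = ∈-++⁺ʳ levels (∈-++⁺ˡ (∈-map⁺ (lower (c * m) P Q h) (∈-upTo⁺ (s≤s i≤M))))

    upper∈ : ∀ m P Q h {i} → i ≤ M → upper (c * m) P Q h i ∈ with-chains m P Q h
    upper∈ m P Q h i≤M = ∈-++⁺ʳ levels (∈-++⁺ʳ (map (lower (c * m) P Q h) (upTo (suc M)))
      (∈-map⁺ (upper (c * m) P Q h) (∈-upTo⁺ (s≤s i≤M))))

    at₀ : ∀ f u v {ℓ ℓ′ i C} → Run a c f u v ℓ i (suc R) C → ℓ′ ≡ ℓ →
          f (pt a c f u v ℓ′ i) ≡ C
    at₀ f u v {ℓ} {i = i} run refl =
      trans (cong (λ p → f (pt a c f u v ℓ p)) (sym (+-identityʳ i))) (run .at 0 (s≤s z≤n))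

    -- For μ = 1 the levels `ℓ₀` and `ℓ₁` coincide, yet carry opposite colours.
    obstruction-≡ : r ≡ c → Obstruction a c
    obstruction-≡ r≡c = M , levels , levels-independent , λ f u v nm →
      case ladder f u v nm of λ where
        (i , C , _ , run₀ , run₁ , _ , _) →
          ≡⇒≢opposite (at₀ f u v run₀ refl)
            (at₀ f u v run₁ (cong (λ x → c * (c * c * x)) (sym r≡c)))

    -- `ℓˣ`, `ℓʸ`, `ℓᶻ` are the levels of x, ρy, ρ²z, and primes mark μ-images; `choose` supplies
    -- the run on each from the four available.
    chains-obstruction : ∀ m P h {ℓˣ ℓʸ ℓʸ′ ℓᶻ ℓᶻ′} → let Q = P + h in
      1 ≤ m → 1 ≤ P → Q + P ≤ R →
      c * m * P * P ≡ ℓˣ → c * m * P * Q ≡ ℓʸ → c * m * Q * Q ≡ ℓᶻ →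
      r * ℓʸ ≡ c * ℓʸ′ → r * ℓᶻ ≡ c * ℓᶻ′ →
      (∀ f u v {i C} →
        Run a c f u v ℓ₀ i (suc R) C → Run a c f u v ℓ₁ i (suc R) (opposite C) →
        Run a c f u v ℓ₂ i (suc R) C → Run a c f u v ℓ₃ i (suc R) (opposite C) →
        Σ Sign λ D → Run a c f u v ℓˣ i (suc R) D ×
          Run a c f u v ℓʸ i (suc R) (opposite D) × Run a c f u v ℓʸ′ i (suc R) D ×
          Run a c f u v ℓᶻ i (suc R) D × Run a c f u v ℓᶻ′ i (suc R) (opposite D)) →
      Obstruction a c
    chains-obstruction m P h m⁺ P⁺ Q+P≤R refl refl refl eqʸ eqᶻ choose =
      M , with-chains m P Q h , with-chains-independent h m⁺ P⁺ (≤-trans P⁺ (m≤m+n P h)) ,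
      λ f u v nm → case ladder f u v (λ p∈ → nm (∈-++⁺ˡ p∈)) of λ where
        (i , C , i≤M , run₀ , run₁ , run₂ , run₃) →
          case choose f u v run₀ run₁ run₂ run₃ of λ where
            (D , runˣ , runʸ , runʸ′ , runᶻ , runᶻ′) →
              chains-meet a c f u v m P h i D
                (nm (lower∈ m P Q h i≤M)) (nm (upper∈ m P Q h i≤M)) (≤-trans (s≤s Q≤R) R<M) P⁺
                (at₀ f u v runˣ refl)
                (runʸ .at Q (s≤s Q≤R)) (runᶻ .at (Q + P) (s≤s Q+P≤R))
                eqʸ (runʸ′ .at Q (s≤s Q≤R)) eqᶻ (runᶻ′ .at (Q + P) (s≤s Q+P≤R))
      where
      Q : ℕ
      Q = P + h
      Q≤R : Q ≤ R
      Q≤R = ≤-trans (m≤m+n Q P) Q+P≤R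

    -- Here ρ = μ: x, ρy, ρ²z climb through `ℓ₀`, `ℓ₁`, `ℓ₂`.
    obstruction-> : ∀ h → c + h ≡ r → Obstruction a c
    obstruction-> h eq = chains-obstruction c c h c⁺ c⁺ (≤-reflexive (cong (_+ c) eq))
      (x-level c) (trans (cong (c * c * c *_) eq) (y-level c r))
      (trans (cong (λ Q → c * c * Q * Q) eq) (z-level c r)) (up₁ c r) (up₂ c r)
      λ f u v run₀ run₁ run₂ run₃ → _ , run₀ , run₁ , run₂ , run₂ , run₃
      where
      x-level : ∀ c → c * c * c * c ≡ c * (c * c * c)
      x-level = solve-∀
      y-level : ∀ c r → c * c * c * r ≡ c * (c * c * r)
      y-level = solve-∀
      z-level : ∀ c r → c * c * r * r ≡ c * (c * r * r)
      z-level = solve-∀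

    -- Here ρ = 1/μ: x, ρy, ρ²z descend through `ℓ₃`, `ℓ₂`, `ℓ₁`, with the colours exchanged.
    obstruction-< : ∀ h → r + h ≡ c → Obstruction a c
    obstruction-< h eq = chains-obstruction r r h r⁺ r⁺
      (≤-reflexive (trans (cong (_+ r) eq) (+-comm c r)))
      (x-level c r) (trans (cong (c * r * r *_) eq) (y-level c r))
      (trans (cong (λ Q → c * r * Q * Q) eq) (z-level c r)) (up₂ c r) (up₁ c r)
      λ f u v {i} {C} run₀ run₁ run₂ run₃ → opposite C , run₃ ,
        subst (Run a c f u v ℓ₂ i (suc R)) (sym (opposite² C)) run₂ , run₃ , run₁ ,
        subst (Run a c f u v ℓ₂ i (suc R)) (sym (opposite² C)) run₂
      where
      x-level : ∀ c r → c * r * r * r ≡ c * (r * r * r)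
      x-level = solve-∀
      y-level : ∀ c r → c * r * r * c ≡ c * (c * r * r)
      y-level = solve-∀
      z-level : ∀ c r → c * r * c * c ≡ c * (c * c * r)
      z-level = solve-∀

  obstruction : Obstruction a c
  obstruction with <-cmp r c
  ... | tri< r<c _ _ = let h , eq = m≤n⇒∃[o]m+o≡n (<⇒≤ r<c) in obstruction-< h eq
  ... | tri≈ _ r≡c _ = obstruction-≡ r≡c
  ... | tri> _ _ r>c = let h , eq = m≤n⇒∃[o]m+o≡n (<⇒≤ r>c) in obstruction-> h eq

-- Recovering the parameters from two terms.

independent⇒injective : ∀ p {u v u′ v′} → Independent p →
  base p u v ≡ base p u′ v′ → step p u v ≡ step p u′ v′ → u ≡ u′ × v ≡ v′
independent⇒injective (prog α β γ δ) {u} {v} {u′} {v′} ind eqb eqs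
  -- `suc e` is the determinant; what follows is Cramer's rule with the negative products moved
  -- across.
  with e , eq ← m≤n⇒∃[o]m+o≡n ind =
  *-cancelˡ-≡ u u′ (suc e) (+-cancelˡ-≡ (γ * β * u + β * δ * v) _ _ (begin
    γ * β * u + β * δ * v + suc e * u         ≡⟨ toᵘ (γ * β) e u (β * δ * v) ⟩
    (suc (γ * β) + e) * u + β * δ * v         ≡⟨ cong (λ x → x * u + β * δ * v) eq ⟩
    α * δ * u + β * δ * v                     ≡⟨ pull δ α β u v ⟩
    δ * (α * u + β * v)                       ≡⟨ cong (δ *_) eqb ⟩
    δ * (α * u′ + β * v′)                     ≡⟨ pull δ α β u′ v′ ⟨
    α * δ * u′ + β * δ * v′                   ≡⟨ cong (λ x → x * u′ + β * δ * v′) eq ⟨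
    (suc (γ * β) + e) * u′ + β * δ * v′       ≡⟨ fromᵘ (γ * β) e u′ (β * δ * v′) ⟩
    γ * β * u′ + β * δ * v′ + suc e * u′      ≡⟨ cong (_+ suc e * u′) (same β γ δ u′ v′) ⟩
    β * (γ * u′ + δ * v′) + suc e * u′        ≡⟨ cong (λ x → β * x + suc e * u′) eqs ⟨
    β * (γ * u + δ * v) + suc e * u′          ≡⟨ cong (_+ suc e * u′) (same β γ δ u v) ⟨
    γ * β * u + β * δ * v + suc e * u′        ∎)) ,
  *-cancelˡ-≡ v v′ (suc e) (+-cancelˡ-≡ (α * γ * u + γ * β * v) _ _ (begin
    α * γ * u + γ * β * v + suc e * v         ≡⟨ toᵛ (γ * β) e v (α * γ * u) ⟩
    α * γ * u + (suc (γ * β) + e) * v         ≡⟨ cong (λ x → α * γ * u + x * v) eq ⟩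
    α * γ * u + α * δ * v                     ≡⟨ pull′ α γ δ u v ⟩
    α * (γ * u + δ * v)                       ≡⟨ cong (α *_) eqs ⟩
    α * (γ * u′ + δ * v′)                     ≡⟨ pull′ α γ δ u′ v′ ⟨
    α * γ * u′ + α * δ * v′                   ≡⟨ cong (λ x → α * γ * u′ + x * v′) eq ⟨
    α * γ * u′ + (suc (γ * β) + e) * v′       ≡⟨ toᵛ (γ * β) e v′ (α * γ * u′) ⟨
    α * γ * u′ + γ * β * v′ + suc e * v′      ≡⟨ cong (_+ suc e * v′) (same′ α β γ u′ v′) ⟩
    γ * (α * u′ + β * v′) + suc e * v′        ≡⟨ cong (λ x → γ * x + suc e * v′) eqb ⟨
    γ * (α * u + β * v) + suc e * v′          ≡⟨ cong (_+ suc e * v′) (same′ α β γ u v) ⟨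
    α * γ * u + γ * β * v + suc e * v′        ∎))
  where
  open ≡-Reasoning
  toᵘ : ∀ g e u w → g * u + w + suc e * u ≡ (suc g + e) * u + w
  toᵘ = solve-∀
  fromᵘ : ∀ g e u w → (suc g + e) * u + w ≡ g * u + w + suc e * u
  fromᵘ = solve-∀
  toᵛ : ∀ g e v w → w + g * v + suc e * v ≡ w + (suc g + e) * v
  toᵛ = solve-∀
  pull : ∀ δ α β u v → α * δ * u + β * δ * v ≡ δ * (α * u + β * v)
  pull = solve-∀
  pull′ : ∀ α γ δ u v → α * γ * u + α * δ * v ≡ α * (γ * u + δ * v)
  pull′ = solve-∀
  same : ∀ β γ δ u v → γ * β * u + β * δ * v ≡ β * (γ * u + δ * v)
  same = solve-∀
  same′ : ∀ α β γ u v → α * γ * u + γ * β * v ≡ γ * (α * u + β * v)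
  same′ = solve-∀

progression-injective : ∀ {b d b′ d′ i j} → i < j → b + i * d ≡ b′ + i * d′ →
                        b + j * d ≡ b′ + j * d′ → b ≡ b′ × d ≡ d′
progression-injective {b} {d} {b′} {d′} {i} i<j eqi eqj
  with k , refl ← m≤n⇒∃[o]m+o≡n i<j =
  +-cancelʳ-≡ (i * d) b b′ (trans eqi (cong (λ x → b′ + i * x) (sym d≡d′))) , d≡d′
  where
  split : ∀ b d i k → b + (suc i + k) * d ≡ b + i * d + suc k * d
  split = solve-∀
  d≡d′ : d ≡ d′
  d≡d′ = *-cancelˡ-≡ d d′ (suc k) (+-cancelˡ-≡ (b + i * d) _ _
    (trans (sym (split b d i k)) (trans eqj (trans (split b′ d′ i k) (cong (_+ suc k * d′) (sym eqi))))))

-- Colours ℕ, continuing f by the junk colour + outside [n].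
extend₀ extend : ∀ {n} → Coloring n → ℕ → Sign
extend₀ {zero}  f k       = plus
extend₀ {suc n} f zero    = f zero
extend₀ {suc n} f (suc k) = extend₀ (λ i → f (suc i)) k
extend f zero    = plus
extend f (suc k) = extend₀ f k

extend-elt : ∀ {n} (f : Coloring n) i → extend f (elt i) ≡ f i
extend-elt f zero    = refl
extend-elt f (suc i) = extend-elt (λ i → f (suc i)) i

preimage : ∀ {n k} → 1 ≤ k → k ≤ n → Σ (Fin n) λ i → elt i ≡ k
preimage (s≤s z≤n) k≤n = fromℕ< k≤n , cong suc (toℕ-fromℕ< k≤n)

elt-injective : ∀ {n} {i j : Fin n} → elt i ≡ elt j → i ≡ j
elt-injective eq = toℕ-injective (suc-injective eq)

elt≤ : ∀ {n} (i : Fin n) → elt i ≤ n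
elt≤ = toℕ<n

-- Bounds on the terms.

CoefficientsBelow : ℕ → Progression → Set
CoefficientsBelow K p = (α p ≤ K × β p ≤ K) × (γ p ≤ K × δ p ≤ K)

coefficients-bounded : ∀ ps → ∃ λ K → All (CoefficientsBelow K) ps
coefficients-bounded [] = 0 , []
coefficients-bounded (p ∷ ps) with K , below ← coefficients-bounded ps =
  S + K ,
  ((le (≤-trans (m≤m+n _ _) (m≤m+n _ _)) , le (≤-trans (m≤n+m _ (α p)) (m≤m+n _ _))) ,
   (le (≤-trans (m≤m+n _ _) (m≤n+m _ (α p + β p))) , le (≤-trans (m≤n+m _ (γ p)) (m≤n+m _ (α p + β p))))) ∷
  All.map (λ ((x , y) , (z , w)) → (up x , up y) , (up z , up w)) below
  where
  S : ℕ
  S = (α p + β p) + (γ p + δ p)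
  le : ∀ {x} → x ≤ S → x ≤ S + K
  le x≤S = ≤-trans x≤S (m≤m+n S K)
  up : ∀ {x} → x ≤ K → x ≤ S + K
  up x≤K = ≤-trans x≤K (m≤n+m K S)

combination≤ : ∀ {x y u v K m} → x ≤ K → y ≤ K → u ≤ m → v ≤ m → x * u + y * v ≤ (K + K) * m
combination≤ {K = K} {m} x≤K y≤K u≤m v≤m =
  ≤-trans (+-mono-≤ (*-mono-≤ x≤K u≤m) (*-mono-≤ y≤K v≤m)) (≤-reflexive (sym (*-distribʳ-+ m K K)))

-- If `α` were 0, the determinant could not be positive.
independent⇒base-positive : ∀ p {u v} → Independent p → 1 ≤ u → 1 ≤ base p u v
independent⇒base-positive p@(prog (suc _) _ _ _) _ u⁺ = ≤-trans u⁺ (≤-trans (m≤m+n _ _) (m≤m+n _ _))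

-- Counting solutions in [n].

module _ (a c : ℕ) (a⁺ : 1 ≤ a) (c⁺ : 1 ≤ c) (M : ℕ) (ps : List Progression)
         (independent : All Independent ps) (K : ℕ) (below : All (CoefficientsBelow K) ps) where

  -- For `u, v ≤ m` every term is at most `suc M * (K + K) * m`, so `a x + a y`, and with it each
  -- entry, is at most `scale * m`. The successor makes division by `scale` legitimate.
  scale : ℕ
  scale = suc (a * (suc M * (K + K) + suc M * (K + K)))

  module _ {n m : ℕ} (f : Coloring n) (scale*m≤n : scale * m ≤ n) where

    term : Fin (length ps) → Fin (suc M) → ℕ → ℕ → ℕ
    term t i u v = base (lookup ps t) u v + toℕ i * step (lookup ps t) u v

    Hit : Fin m → Fin m → Fin (length ps) → Fin (suc M) → Fin (suc M) → Fin n → Fin n → Fin n → Set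
    Hit u v t i j x y z = toℕ i < toℕ j × elt x ≡ term t i (elt u) (elt v) ×
      elt y ≡ term t j (elt u) (elt v) × MonoSol a c f (x , y , z)

    HitAt : Fin m → Fin m → Set
    HitAt u v = ∃ λ t → ∃ λ i → ∃ λ j → ∃ λ x → ∃ λ y → ∃ λ z → Hit u v t i j x y z

    hitAt? : ∀ u v → Dec (HitAt u v)
    hitAt? u v = any? λ t → any? λ i → any? λ j → any? λ x → any? λ y → any? λ z →
      (toℕ i <? toℕ j) ×-dec (elt x ≟ term t i (elt u) (elt v)) ×-dec
      (elt y ≟ term t j (elt u) (elt v)) ×-dec monoSol? a c f (x , y , z)

    -- Every number occurring lies in [n], so the junk colour of `extend` never matters.
    no-hit⇒NoMono : ∀ u v → ¬ HitAt u v → ∀ {p} → p ∈ ps →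
                    NoMonoOn a c (extend f) (elt u) (elt v) M p
    no-hit⇒NoMono u v ¬hit {p} p∈ {i} {j} {z} i<j j≤M eq fxy fzx
      with preimage (positive i) (x≤n (≤-trans (<⇒≤ i<j) j≤M)) | preimage (positive j) (x≤n j≤M)
         | preimage z⁺ z-in-range
      where
      b d : ℕ
      b = base p (elt u) (elt v)
      d = step p (elt u) (elt v)
      bound : ℕ
      bound = suc M * (K + K)
      positive : ∀ i → 1 ≤ b + i * d
      positive i = ≤-trans (independent⇒base-positive p (All.lookup independent p∈) (s≤s z≤n)) (m≤m+n _ _)
      term≤ : ∀ {i} → i ≤ M → b + i * d ≤ bound * m
      term≤ {i} i≤M with (α≤ , β≤) , (γ≤ , δ≤) ← All.lookup below p∈ =
        ≤-trans (+-mono-≤ (combination≤ α≤ β≤ (elt≤ u) (elt≤ v))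
                          (*-mono-≤ i≤M (combination≤ γ≤ δ≤ (elt≤ u) (elt≤ v))))
                (≤-reflexive (sym (*-assoc (suc M) (K + K) m)))
      sum≤n : ∀ {x y} → x ≤ bound * m → y ≤ bound * m → a * x + a * y ≤ n
      sum≤n {x} {y} x≤ y≤ = ≤-trans (+-mono-≤ (*-monoʳ-≤ a x≤) (*-monoʳ-≤ a y≤))
        (≤-trans (≤-reflexive (factor a bound m)) (≤-trans (*-monoˡ-≤ m (n≤1+n (a * (bound + bound)))) scale*m≤n))
        where
        factor : ∀ a b m → a * (b * m) + a * (b * m) ≡ a * (b + b) * m
        factor = solve-∀
      x≤n : ∀ {i} → i ≤ M → b + i * d ≤ n
      x≤n {i} i≤M = ≤-trans (m≤n*m _ a {{>-nonZero a⁺}})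
        (≤-trans (m≤m+n _ _) (sum≤n (term≤ i≤M) (term≤ i≤M)))
      z-in-range : z ≤ n
      z-in-range = ≤-trans (m≤n*m z c {{>-nonZero c⁺}})
        (≤-trans (≤-reflexive (sym eq)) (sum≤n (term≤ (≤-trans (<⇒≤ i<j) j≤M)) (term≤ j≤M)))
      z⁺ : 1 ≤ z
      z⁺ = n≢0⇒n>0 λ where
        refl → <⇒≢ (≤-trans (*-mono-≤ a⁺ (positive i)) (m≤m+n _ _)) (sym (trans eq (*-zeroʳ c)))
    ... | x , ex | y , ey | w , ew = ¬hit
      (index p∈ , fromℕ< i<1+M , fromℕ< j<1+M , x , y , w ,
       subst₂ _<_ (sym (toℕ-fromℕ< i<1+M)) (sym (toℕ-fromℕ< j<1+M)) i<j ,
       trans ex (relabel i<1+M) , trans ey (relabel j<1+M) ,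
       trans (cong₂ (λ s t → a * s + a * t) ex ey) (trans eq (cong (c *_) (sym ew))) ,
       fx≡fz , trans (sym fx≡fy) fx≡fz)
      where
      j<1+M : j < suc M
      j<1+M = s≤s j≤M
      i<1+M : i < suc M
      i<1+M = <-trans i<j j<1+M
      relabel : ∀ {k} (k<1+M : k < suc M) →
        base p (elt u) (elt v) + k * step p (elt u) (elt v) ≡
        term (index p∈) (fromℕ< k<1+M) (elt u) (elt v)
      relabel k<1+M = cong₂ (λ q k → base q (elt u) (elt v) + k * step q (elt u) (elt v))
        (lookup-index p∈) (sym (toℕ-fromℕ< k<1+M))
      colour : ∀ {k} i → elt i ≡ k → extend f k ≡ f i
      colour i refl = extend-elt f i
      fx≡fz : f x ≡ f w
      fx≡fz = trans (sym (colour x ex)) (trans (sym fzx) (colour w ew))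
      fx≡fy : f x ≡ f y
      fx≡fy = trans (sym (colour x ex)) (trans fxy (colour y ey))

    module _ (hits : ∀ u v → HitAt u v) where

      solutions : List (Fin n × Fin n × Fin n)
      solutions = filter (monoSol? a c f) (triples n)

      mono∈ : ∀ {t} → MonoSol a c f t → t ∈ solutions
      mono∈ {x , y , z} = ∈-filter⁺ (monoSol? a c f)
        (∈-cartesianProduct⁺ (∈-allFin x) (∈-cartesianProduct⁺ (∈-allFin y) (∈-allFin z)))

      position : ∀ {t} → MonoSol a c f t → Fin (monoCount a c f)
      position mono = index (mono∈ mono)

      position-injective : ∀ {s t} (σ : MonoSol a c f s) (τ : MonoSol a c f t) →
                           position σ ≡ position τ → s ≡ t
      position-injective σ τ eq = trans (lookup-index (mono∈ σ))
        (trans (cong (lookup solutions) eq) (sym (lookup-index (mono∈ τ))))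

      encode : Fin m × Fin m → Fin (length ps * (suc M * suc M) * monoCount a c f)
      encode (u , v) = case hits u v of λ where
        (t , i , j , x , y , z , _ , _ , _ , mono) →
          combine (combine t (combine i j)) (position mono)

      -- Equal codes give the same solution and the same `t`, `i`, `j`. Its first two entries fix
      -- base and step, and independence then fixes `(u, v)`.
      encode-injective : Injective _≡_ _≡_ encode
      encode-injective {u , v} {u′ , v′} eq with hits u v | hits u′ v′
      ... | t , i , j , x , y , z , i<j , ex , ey , mono
          | t′ , i′ , j′ , x′ , y′ , z′ , _ , ex′ , ey′ , mono′
        with label≡ , pos≡ ← combine-injective (combine t (combine i j)) (position mono)
                               (combine t′ (combine i′ j′)) (position mono′) eq
        with refl , ij≡ ← combine-injective t (combine i j) t′ (combine i′ j′) label≡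
        with refl , refl ← combine-injective i j i′ j′ ij≡
        with refl ← position-injective mono mono′ pos≡
        with b≡ , d≡ ← progression-injective i<j (trans (sym ex) ex′) (trans (sym ey) ey′)
        with u≡ , v≡ ← independent⇒injective (lookup ps t) (All.lookup independent (∈-lookup t)) b≡ d≡
        = cong₂ _,_ (elt-injective u≡) (elt-injective v≡)

      square≤ : m * m ≤ length ps * (suc M * suc M) * monoCount a c f
      square≤ = injective⇒≤ {f = λ k → encode (remQuot m k)} λ {k} {l} eq →
        trans (sym (combine-remQuot {m} m k))
          (trans (cong (uncurry combine) (encode-injective eq)) (combine-remQuot {m} m l))

theorem3p2 : (a c : ℕ) → 1 ≤ a → 1 ≤ c →
    Σ ℕ λ p → Σ ℕ λ q → Σ ℕ λ N → (1 ≤ p) × (1 ≤ q) ×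
    ((n : ℕ) → n ≥ N → (f : Coloring n) →
    p * (n ^ 2) ≤ q * monoCount a c f)
theorem3p2 a c a⁺ c⁺
  with M , ps , independent , obstructs ← obstruction a c a⁺ c⁺
  with K , below ← coefficients-bounded ps =
  -- κ is `1 / q`, with `q` from n ≤ 2Dm and m² ≤ labels · count; the successor gives `1 ≤ q` even
  -- if `labels` is 0. `n ≥ D` ensures `m ≥ 1`, which absorbs the remainder of `n` modulo `D`.
  1 , suc (4 * (D * D) * labels) , D , ≤-refl , s≤s z≤n , λ n n≥D f →
  let
    m : ℕ
    m = n / D
    Dm≤n : D * m ≤ n
    Dm≤n = ≤-trans (≤-reflexive (*-comm D m)) (m/n*n≤m n D)
    m⁺ : 1 ≤ m
    m⁺ = m≥n⇒m/n>0 n≥D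
    n≤2Dm : n ≤ 2 * D * m
    n≤2Dm = ≤-trans (≤-reflexive (m≡m%n+[m/n]*n n D)) (≤-trans
      (+-monoˡ-≤ (m * D) (≤-trans (<⇒≤ (m%n<n n D)) (m≤n*m D m {{>-nonZero m⁺}})))
      (≤-reflexive (double m D)))
    hits : ∀ u v → HitAt a c a⁺ c⁺ M ps independent K below f Dm≤n u v
    -- The obstruction only refutes the absence of a hit; a finite search turns this into a hit.
    hits u v = decidable-stable (hitAt? a c a⁺ c⁺ M ps independent K below f Dm≤n u v) λ ¬hit →
      obstructs (extend f) (elt u) (elt v)
        (no-hit⇒NoMono a c a⁺ c⁺ M ps independent K below f Dm≤n u v ¬hit)
  in begin
    1 * n ^ 2                                     ≡⟨ square n ⟩
    n * n                                         ≤⟨ *-mono-≤ n≤2Dm n≤2Dm ⟩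
    2 * D * m * (2 * D * m)                       ≡⟨ regroup D m ⟩
    4 * (D * D) * (m * m)                         ≤⟨ *-monoʳ-≤ (4 * (D * D)) (square≤ a c a⁺ c⁺ M ps independent K below f Dm≤n hits) ⟩
    4 * (D * D) * (labels * monoCount a c f)      ≡⟨ *-assoc (4 * (D * D)) labels _ ⟨
    4 * (D * D) * labels * monoCount a c f        ≤⟨ *-monoˡ-≤ (monoCount a c f) (n≤1+n (4 * (D * D) * labels)) ⟩
    suc (4 * (D * D) * labels) * monoCount a c f  ∎
  where
  open ≤-Reasoning
  labels D : ℕ
  labels = length ps * (suc M * suc M)
  D = scale a c a⁺ c⁺ M ps independent K below
  double : ∀ m D → m * D + m * D ≡ 2 * D * m
  double = solve-∀
  square : ∀ n → 1 * (n ^ 2) ≡ n * n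
  square n = trans (*-identityˡ (n ^ 2)) (cong (n *_) (*-identityʳ n))
  regroup : ∀ D m → 2 * D * m * (2 * D * m) ≡ 4 * (D * D) * (m * m)
  regroup = solve-∀
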